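{- Let $G$ be a graph with $n$ vertices and maximum cut $\beta$. Then \[\gamma_{ir}(G) \geq n + \frac{1- \sqrt{1+8 \beta}}{2}.\] Moreover, the bound is sharp: there exist graphs for which equality holds.
   Context: All graphs are finite, simple, undirected and have at least one vertex. $N(v)$ denotes the set of neighbours of a vertex $v$. A dominating set of $G$ is a set $D \subseteq V(G)$ such that every vertex in $V(G)\setminus D$ has a neighbour in $D$. An irregular dominating set of $G$ is a dominating set $D$ of $G$ such that $|N(u) \cap D| \neq |N(v) \cap D|$ for every two distinct vertices $u, v \in V(G) \setminus D$ (in particular, $V(G)$ is one). The irregular domination number $\gamma_{ir}(G)$ is the size of a smallest irregular dominating set of $G$. For $A \subseteq V(G)$, $e(A, V(G)\setminus A)$ is the number of edges of $G$ with one vertex in $A$ and the other in $V(G) \setminus A$. The maximum cut of $G$ is $\beta = \beta(G) = \max\{e(A, V(G)\setminus A) : A \subseteq V(G)\}$. -}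

module Defs where

open import Data.Empty using (⊥-elim)
open import Data.Fin.Base using (Fin) renaming (_<_ to _<ᶠ_)
open import Data.Fin.Properties using (all?; any?) renaming (_≟_ to _≟ᶠ_; _<?_ to _<ᶠ?_)
open import Data.Fin.Subset using (Subset; inside; outside; _∈_; _∉_; _∩_; ∣_∣; ⊥; ⊤)
open import Data.Fin.Subset.Properties using (_∈?_; ∈⊤)
open import Data.Integer.Base as ℤ using (+_)
open import Data.Integer.Properties as ℤₚ using ()
open import Data.List.Base using (List; []; _∷_; [_]; map; filter; length; _++_; allFin; cartesianProduct)
open import Data.List.Extrema.Nat using (min; max; argmin-sel; argmax-sel; min≤xs; xs≤max)
open import Data.List.Membership.Propositional using () renaming (_∈_ to _∈ˡ_)
open import Data.List.Membership.Propositional.Properties using (∈-map⁺; ∈-map⁻; ∈-filter⁺; ∈-filter⁻; ∈-++⁺ˡ; ∈-++⁺ʳ)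
open import Data.List.Relation.Unary.All using (lookup)
open import Data.List.Relation.Unary.Any using (here)
open import Data.Nat.Base as ℕ using (ℕ; zero; suc)
open import Data.Nat.Properties as ℕₚ using ()
open import Data.Product.Base using (∃; _×_; _,_; proj₂)
open import Data.Rational.Base as ℚ using (ℚ; 0ℚ; 1ℚ; ½; mkℚ; *≤*) hiding (module ℚ)
open import Data.Rational.Properties as ℚₚ using ()
open import Data.Rational.Literals using (fromℤ)
open import Data.Rational.Unnormalised.Base using (*≡*)
open import Data.Rational.Unnormalised.Properties as ℚᵘₚ using ()
open import Data.Rational.Solver using (module +-*-Solver)
open import Data.Sum.Base using (_⊎_; inj₁; inj₂; swap)
open import Data.Vec.Base using (tabulate) renaming ([] to []ᵛ; _∷_ to _∷ᵛ_)
open import Level using (0ℓ)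
open import Relation.Binary.Core using (Rel)
open import Relation.Binary.Definitions using (Symmetric; Irreflexive; Decidable)
open import Relation.Binary.PropositionalEquality using (_≡_; _≢_; refl; sym; trans; cong; subst; subst₂)
open import Relation.Nullary.Decidable using (Dec; yes; no; does; ¬?; _×-dec_; _⊎-dec_; _→-dec_)
open import Relation.Nullary.Negation using (¬_)

module ℚ-Lemmas where
  open ℚ using (_+_; _*_; _-_; -_; _<_; _≤_; 1/_; _/_)
  open +-*-Solver

  multiple : ℕ → ℚ → ℚ
  multiple zero    x = 0ℚ
  multiple (suc k) x = x + multiple k x

  abstract
    x+[y-x]≡y : ∀ x y → x + (y - x) ≡ y
    x+[y-x]≡y = solve 2 (λ x y → x :+ (y :- x) := y) refl

    0<y-x⇒x<y : ∀ {x y} → 0ℚ < y - x → x < y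
    0<y-x⇒x<y {x} {y} h =
      subst₂ _<_ (ℚₚ.+-identityʳ x) (x+[y-x]≡y x y) (ℚₚ.+-monoʳ-< x h)

    x<y⇒0<y-x : ∀ {x y} → x < y → 0ℚ < y - x
    x<y⇒0<y-x {x} {y} h =
      subst (_< y - x) (ℚₚ.+-inverseʳ x) (ℚₚ.+-monoˡ-< (- x) h)

    +-pos : ∀ {x y} → 0ℚ < x → 0ℚ < y → 0ℚ < x + y
    +-pos {x} {y} hx hy = subst (_< x + y) (ℚₚ.+-identityʳ 0ℚ) (ℚₚ.+-mono-< hx hy)

    +-nonNeg : ∀ {x y} → 0ℚ ≤ x → 0ℚ ≤ y → 0ℚ ≤ x + y
    +-nonNeg {x} {y} hx hy = subst (_≤ x + y) (ℚₚ.+-identityʳ 0ℚ) (ℚₚ.+-mono-≤ hx hy)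

    *-pos : ∀ {x y} → 0ℚ < x → 0ℚ < y → 0ℚ < x * y
    *-pos {x} {y} hx hy =
      subst (_< x * y) (ℚₚ.*-zeroʳ x) (ℚₚ.*-monoʳ-<-pos x {{ℚ.positive hx}} hy)

    *-nonNeg : ∀ {x y} → 0ℚ ≤ x → 0ℚ ≤ y → 0ℚ ≤ x * y
    *-nonNeg {x} {y} hx hy =
      subst (_≤ x * y) (ℚₚ.*-zeroʳ x) (ℚₚ.*-monoˡ-≤-nonNeg x {{ℚ.nonNegative hx}} hy)

    square-mono-< : ∀ {x y} → 0ℚ ≤ x → x < y → x * x < y * y
    square-mono-< {x} {y} 0≤x x<y = ℚₚ.≤-<-trans
      (ℚₚ.*-monoˡ-≤-nonNeg x {{ℚ.nonNegative 0≤x}} (ℚₚ.<⇒≤ x<y))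
      (ℚₚ.*-monoˡ-<-pos y {{ℚ.positive (ℚₚ.≤-<-trans 0≤x x<y)}} x<y)

    reciprocal : ∀ {x} → 0ℚ < x → ∃ λ d → 0ℚ < d × x * d ≡ 1ℚ
    reciprocal {x} 0<x = (1/ x) , ℚₚ.positive⁻¹ (1/ x) {{ℚₚ.1/pos⇒pos x}} , ℚₚ.*-inverseʳ x
      where
      instance
        x-pos : ℚ.Positive x
        x-pos = ℚ.positive 0<x
        x-nonZero : ℚ.NonZero x
        x-nonZero = ℚₚ.pos⇒nonZero x

    0<1 : 0ℚ < 1ℚ
    0<1 = ℚₚ.positive⁻¹ 1ℚ

    halve : ∀ x → (½ * x) + (½ * x) ≡ x
    halve x = trans (sym (ℚₚ.*-distribʳ-+ x ½ ½)) (ℚₚ.*-identityˡ x)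

    double-mono-< : ∀ {x y} → x < y → x + x < y + y
    double-mono-< h = ℚₚ.+-mono-< h h

    x<x+pos : ∀ x {y} → 0ℚ < y → x < x + y
    x<x+pos x {y} 0<y = 0<y-x⇒x<y (subst (0ℚ <_) (solve 2 (λ x y → y := (x :+ y) :- x) refl x y) 0<y)

    x+y-y≡x : ∀ x y → (x + y) - y ≡ x
    x+y-y≡x = solve 2 (λ x y → (x :+ y) :- y := x) refl

    x-y+y≡x : ∀ x y → (x - y) + y ≡ x
    x-y+y≡x = solve 2 (λ x y → (x :- y) :+ y := x) refl

    neg-involutive : ∀ x → - (- x) ≡ x
    neg-involutive = solve 1 (λ x → :- (:- x) := x) refl

    ½-double : ∀ x → ½ * (x + x) ≡ x
    ½-double x = trans (ℚₚ.*-distribˡ-+ ½ x x) (halve x)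

    ½-mono-< : ∀ {x y} → x < y → ½ * x < ½ * y
    ½-mono-< = ℚₚ.*-monoʳ-<-pos ½

    x-1<x : ∀ x → x - 1ℚ < x
    x-1<x x = 0<y-x⇒x<y (subst (0ℚ <_) (solve 2 (λ x u → u := x :- (x :- u)) refl x 1ℚ) 0<1)

    x<x+1 : ∀ x → x < x + 1ℚ
    x<x+1 x = x<x+pos x 0<1

    neg-swapˡ-< : ∀ {x y} → - x < y → - y < x
    neg-swapˡ-< {x} {y} h = subst (- y <_) (neg-involutive x) (ℚₚ.neg-antimono-< h)

    neg-swapʳ-< : ∀ {x y} → x < - y → y < - x
    neg-swapʳ-< {x} {y} h = subst (_< - x) (neg-involutive y) (ℚₚ.neg-antimono-< h)

    0≤fromℕ : ∀ n → 0ℚ ≤ fromℤ (+ n)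
    0≤fromℕ n = ℚₚ.nonNegative⁻¹ (fromℤ (+ n))

    fromℕ-suc : ∀ n → 1ℚ + fromℤ (+ n) ≡ fromℤ (+ suc n)
    fromℕ-suc n = ℚₚ.toℚᵘ-injective
      (ℚᵘₚ.≃-trans (ℚₚ.toℚᵘ-homo-+ 1ℚ (fromℤ (+ n)))
                   (*≡* (cong (ℤ._* + 1) (cong (ℤ._+_ (+ 1)) (ℤₚ.*-identityʳ (+ n))))))

    multiple-* : ∀ k x y → multiple k x * y ≡ multiple k (x * y)
    multiple-* zero    x y = ℚₚ.*-zeroˡ y
    multiple-* (suc k) x y =
      trans (ℚₚ.*-distribʳ-+ y x (multiple k x)) (cong (λ z → x * y + z) (multiple-* k x y))

    multiple-1 : ∀ k → multiple k 1ℚ ≡ fromℤ (+ k)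
    multiple-1 zero    = refl
    multiple-1 (suc k) = trans (cong (λ z → 1ℚ + z) (multiple-1 k)) (fromℕ-suc k)

    ≤∣numerator∣ : ∀ p → p ≤ fromℤ (+ ℤ.∣ ℚ.↥ p ∣)
    ≤∣numerator∣ p@(mkℚ n d _) = *≤* (begin
      n ℤ.* + 1                ≡⟨ ℤₚ.*-identityʳ n ⟩
      n                        ≤⟨ i≤∣i∣ n ⟩
      + ℤ.∣ n ∣                ≡⟨ ℤₚ.*-identityʳ (+ ℤ.∣ n ∣) ⟨
      + ℤ.∣ n ∣ ℤ.* + 1        ≤⟨ ℤₚ.*-monoˡ-≤-nonNeg (+ ℤ.∣ n ∣) (ℤ.+≤+ (ℕ.s≤s ℕ.z≤n)) ⟩
      + ℤ.∣ n ∣ ℤ.* + suc d    ∎)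
      where
      open ℤₚ.≤-Reasoning
      i≤∣i∣ : ∀ i → i ℤ.≤ + ℤ.∣ i ∣
      i≤∣i∣ (+ n)       = ℤₚ.≤-refl
      i≤∣i∣ ℤ.-[1+ n ] = ℤ.-≤+

    archimedean : ∀ x {δ} → 0ℚ < δ → ∃ λ k → x ≤ multiple k δ
    archimedean x {δ} 0<δ with reciprocal 0<δ
    ... | d , _ , δd≡1 = k , subst₂ _≤_ lhs rhs
        (ℚₚ.*-monoʳ-≤-nonNeg δ {{ℚ.nonNegative (ℚₚ.<⇒≤ 0<δ)}} (≤∣numerator∣ (x * d)))
      where
      k : ℕ
      k = ℤ.∣ ℚ.↥ (x * d) ∣
      lhs : x * d * δ ≡ x
      lhs = trans (solve 3 (λ x d δ → x :* d :* δ := x :* (δ :* d)) refl x d δ)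
           (trans (cong (x *_) δd≡1) (ℚₚ.*-identityʳ x))
      rhs : fromℤ (+ k) * δ ≡ multiple k δ
      rhs = trans (cong (_* δ) (sym (multiple-1 k)))
           (trans (multiple-* k 1ℚ δ) (cong (multiple k) (ℚₚ.*-identityˡ δ)))

    exchange-< : ∀ {a b q r} → b - a < r - q → q - a < r - b
    exchange-< {a} {b} {q} {r} h = 0<y-x⇒x<y (subst (0ℚ <_)
      (solve 4 (λ a b q r → r :- q :- (b :- a) := r :- b :- (q :- a)) refl a b q r)
      (x<y⇒0<y-x h))

    2δ≡a+2δ-a : ∀ a δ → δ + δ ≡ a + δ + δ - a
    2δ≡a+2δ-a = solve 2 (λ a d → d :+ d := a :+ d :+ d :- a) refl

    -- the witness is q + (a - q²) / (2q + 1 + a)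
    √-openˡ : ∀ {a q} → 0ℚ ≤ a → 0ℚ ≤ q → q * q < a → ∃ λ r → q < r × r * r < a
    √-openˡ {a} {q} 0≤a 0≤q q²<a = witness (reciprocal 0<c)
      where
      c : ℚ
      c = q + q + a + 1ℚ
      0<c : 0ℚ < c
      0<c = ℚₚ.≤-<-trans (+-nonNeg (+-nonNeg 0≤q 0≤q) 0≤a) (x<x+1 (q + q + a))
      witness : (∃ λ d → 0ℚ < d × c * d ≡ 1ℚ) → ∃ λ r → q < r × r * r < a
      witness (d , 0<d , cd≡1) = q + e , x<x+pos q 0<e , 0<y-x⇒x<y 0<a-[q+e]²
        where
        t e m : ℚ
        t = a - q * q
        e = t * d
        m = q * q + a * a + (1ℚ + a) * (q + q) + a + 1ℚ
        0<m : 0ℚ < m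
        0<m = ℚₚ.≤-<-trans
          (+-nonNeg (+-nonNeg (+-nonNeg (*-nonNeg 0≤q 0≤q) (*-nonNeg 0≤a 0≤a))
            (*-nonNeg (+-nonNeg (ℚₚ.<⇒≤ 0<1) 0≤a) (+-nonNeg 0≤q 0≤q))) 0≤a)
          (x<x+1 _)
        0<e : 0ℚ < e
        0<e = *-pos (x<y⇒0<y-x q²<a) 0<d
        identity₁ : ∀ q a d →
          let k = (q + q + a + 1ℚ) * d; t = a - q * q in
          t * d * d * (q * q + a * a + (1ℚ + a) * (q + q) + a + 1ℚ)
            ≡ t * (k * k) - (q + q) * t * d * k - t * d * (t * d)
        identity₁ = solve 3 (λ q a d →
          let u = con 1ℚ
              t = a :- q :* q
              k = (q :+ q :+ a :+ u) :* d
          in t :* d :* d :* (q :* q :+ a :* a :+ (u :+ a) :* (q :+ q) :+ a :+ u)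
             := t :* (k :* k) :- (q :+ q) :* t :* d :* k :- t :* d :* (t :* d)) refl
        identity₂ : ∀ q a d →
          let t = a - q * q in
          t * (1ℚ * 1ℚ) - (q + q) * t * d * 1ℚ - t * d * (t * d)
            ≡ a - (q + t * d) * (q + t * d)
        identity₂ = solve 3 (λ q a d →
          let u = con 1ℚ
              t = a :- q :* q
          in t :* (u :* u) :- (q :+ q) :* t :* d :* u :- t :* d :* (t :* d)
             := a :- (q :+ t :* d) :* (q :+ t :* d)) refl
        0<a-[q+e]² : 0ℚ < a - (q + e) * (q + e)
        0<a-[q+e]² = subst (0ℚ <_)
          (trans (identity₁ q a d)
          (trans (cong (λ k → t * (k * k) - (q + q) * t * d * k - e * e) cd≡1)
                 (identity₂ q a d)))
          (*-pos (*-pos 0<e 0<d) 0<m)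

    -- the witness is (q² + a) / 2q
    √-openʳ : ∀ {a q} → 0ℚ ≤ a → 0ℚ < q → a < q * q →
              ∃ λ r → r < q × 0ℚ < r × a < r * r
    √-openʳ {a} {q} 0≤a 0<q a<q² = witness (reciprocal (+-pos 0<q 0<q))
      where
      witness : (∃ λ d → 0ℚ < d × (q + q) * d ≡ 1ℚ) → ∃ λ r → r < q × 0ℚ < r × a < r * r
      witness (d , 0<d , 2qd≡1) =
        s , s<q , *-pos 0<q²+a 0<d , 0<y-x⇒x<y (subst (0ℚ <_) e²≡s²-a (*-pos 0<e 0<e))
        where
        s e : ℚ
        s = (q * q + a) * d
        e = (q * q - a) * d
        0<e : 0ℚ < e
        0<e = *-pos (x<y⇒0<y-x a<q²) 0<d
        0<q²+a : 0ℚ < q * q + a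
        0<q²+a = subst (_< q * q + a) (ℚₚ.+-identityʳ 0ℚ) (ℚₚ.+-mono-<-≤ (*-pos 0<q 0<q) 0≤a)
        identity₁ : ∀ q a d → (q * q - a) * d ≡ q * ((q + q) * d) - (q * q + a) * d
        identity₁ = solve 3 (λ q a d →
          (q :* q :- a) :* d := q :* ((q :+ q) :* d) :- (q :* q :+ a) :* d) refl
        identity₂ : ∀ q a d → let k = (q + q) * d in
          (q * q - a) * d * ((q * q - a) * d)
            ≡ (q * q + a) * d * ((q * q + a) * d) - a * (k * k)
        identity₂ = solve 3 (λ q a d → let k = (q :+ q) :* d in
          (q :* q :- a) :* d :* ((q :* q :- a) :* d)
            := (q :* q :+ a) :* d :* ((q :* q :+ a) :* d) :- a :* (k :* k)) refl
        s<q : s < q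
        s<q = 0<y-x⇒x<y (subst (0ℚ <_)
          (trans (identity₁ q a d)
          (trans (cong (λ k → q * k - s) 2qd≡1) (cong (_- s) (ℚₚ.*-identityʳ q)))) 0<e)
        e²≡s²-a : e * e ≡ s * s - a
        e²≡s²-a = trans (identity₂ q a d) (cong (λ z → s * s - z)
          (trans (cong (λ k → a * (k * k)) 2qd≡1) (ℚₚ.*-identityʳ a)))

    a<[a+1]² : ∀ {a} → 0ℚ ≤ a → a < (a + 1ℚ) * (a + 1ℚ)
    a<[a+1]² {a} 0≤a = 0<y-x⇒x<y (subst (0ℚ <_)
      (solve 1 (λ a → let u = con 1ℚ in a :* a :+ a :+ u := (a :+ u) :* (a :+ u) :- a) refl a)
      (ℚₚ.≤-<-trans (+-nonNeg (*-nonNeg 0≤a 0≤a) 0≤a) (x<x+1 (a * a + a))))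

-- Real numbers as two-sided Dedekind cuts: L x q means q < x, and U x q
-- means x < q.
record ℝ : Set₁ where
  open ℚ using (_<_)
  field
    L U        : ℚ → Set
    L-bounded  : ∃ L
    U-bounded  : ∃ U
    L-down     : ∀ {q r} → q < r → L r → L q
    U-up       : ∀ {q r} → q < r → U q → U r
    L-open     : ∀ {q} → L q → ∃ λ r → q < r × L r
    U-open     : ∀ {r} → U r → ∃ λ q → q < r × U q
    disjoint   : ∀ {q} → L q → ¬ U q
    located    : ∀ {q r} → q < r → L q ⊎ U r

open ℝ

infix 4 _≤_ _≥_ _≈_

-- By locatedness L determines U, so comparing lower parts suffices.
_≤_ : ℝ → ℝ → Set
x ≤ y = ∀ {q} → L x q → L y q

_≥_ : ℝ → ℝ → Set
x ≥ y = y ≤ x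

_≈_ : ℝ → ℝ → Set
x ≈ y = x ≤ y × y ≤ x

fromℚ : ℚ → ℝ
fromℚ p = record
  { L         = ℚ._< p
  ; U         = p ℚ.<_
  ; L-bounded = p ℚ.- 1ℚ , x-1<x p
  ; U-bounded = p ℚ.+ 1ℚ , x<x+1 p
  ; L-down    = ℚₚ.<-trans
  ; U-up      = λ q<r p<q → ℚₚ.<-trans p<q q<r
  ; L-open    = λ q<p → let r , q<r , r<p = ℚₚ.<-dense q<p in r , q<r , r<p
  ; U-open    = λ p<r → let q , p<q , q<r = ℚₚ.<-dense p<r in q , q<r , p<q
  ; disjoint  = ℚₚ.<-asym
  ; located   = loc
  }
  where
  open ℚ-Lemmas
  loc : ∀ {q r} → q ℚ.< r → q ℚ.< p ⊎ p ℚ.< r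
  loc {q} q<r with q ℚₚ.<? p
  ... | yes q<p = inj₁ q<p
  ... | no  q≮p = inj₂ (ℚₚ.≤-<-trans (ℚₚ.≮⇒≥ q≮p) q<r)

fromℕ : ℕ → ℝ
fromℕ n = fromℚ (fromℤ (+ n))

infix 8 -_ √_
infixl 7 _/2
infixl 6 _+_ _-_

-_ : ℝ → ℝ
- x = record
  { L         = λ q → U x (ℚ.- q)
  ; U         = λ q → L x (ℚ.- q)
  ; L-bounded = let u , Uu = U-bounded x in ℚ.- u , subst (U x) (sym (neg-involutive u)) Uu
  ; U-bounded = let l , Ll = L-bounded x in ℚ.- l , subst (L x) (sym (neg-involutive l)) Ll
  ; L-down    = λ q<r → U-up x (ℚₚ.neg-antimono-< q<r)
  ; U-up      = λ q<r → L-down x (ℚₚ.neg-antimono-< q<r)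
  ; L-open    = λ Uq → let r , r<-q , Ur = U-open x Uq in
                  ℚ.- r , neg-swapʳ-< r<-q , subst (U x) (sym (neg-involutive r)) Ur
  ; U-open    = λ Lq → let r , -q<r , Lr = L-open x Lq in
                  ℚ.- r , neg-swapˡ-< -q<r , subst (L x) (sym (neg-involutive r)) Lr
  ; disjoint  = λ Uq Lq → disjoint x Lq Uq
  ; located   = λ q<r → swap (located x (ℚₚ.neg-antimono-< q<r))
  }
  where
  open ℚ-Lemmas

_/2 : ℝ → ℝ
x /2 = record
  { L         = λ q → L x (q ℚ.+ q)
  ; U         = λ q → U x (q ℚ.+ q)
  ; L-bounded = let l , Ll = L-bounded x in ½ ℚ.* l , subst (L x) (sym (halve l)) Ll
  ; U-bounded = let u , Uu = U-bounded x in ½ ℚ.* u , subst (U x) (sym (halve u)) Uu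
  ; L-down    = λ q<r → L-down x (double-mono-< q<r)
  ; U-up      = λ q<r → U-up x (double-mono-< q<r)
  ; L-open    = λ {q} Lq → let r , 2q<r , Lr = L-open x Lq in
                  ½ ℚ.* r , subst (ℚ._< ½ ℚ.* r) (½-double q) (½-mono-< 2q<r) , subst (L x) (sym (halve r)) Lr
  ; U-open    = λ {q} Uq → let r , r<2q , Ur = U-open x Uq in
                  ½ ℚ.* r , subst (½ ℚ.* r ℚ.<_) (½-double q) (½-mono-< r<2q) , subst (U x) (sym (halve r)) Ur
  ; disjoint  = disjoint x
  ; located   = λ q<r → located x (double-mono-< q<r)
  }
  where
  open ℚ-Lemmas

march : ∀ x {δ} → 0ℚ ℚ.< δ → ∀ k a → L x a → U x (a ℚ.+ ℚ-Lemmas.multiple k δ) →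
        ∃ λ b → L x b × U x (b ℚ.+ δ ℚ.+ δ)
march x {δ} 0<δ zero    a La Ub =
  ⊥-elim (disjoint x La (subst (U x) (ℚₚ.+-identityʳ a) Ub))
march x {δ} 0<δ (suc k) a La Ub with located x (ℚ-Lemmas.x<x+pos (a ℚ.+ δ) 0<δ)
... | inj₁ La+δ  =
  march x 0<δ k (a ℚ.+ δ) La+δ (subst (U x) (sym (ℚₚ.+-assoc a δ (ℚ-Lemmas.multiple k δ))) Ub)
... | inj₂ Ua+2δ = a , La , Ua+2δ

approximate : ∀ x {ε} → 0ℚ ℚ.< ε → ∃ λ a → ∃ λ b → L x a × U x b × b ℚ.- a ℚ.< ε
approximate x {ε} 0<ε =
  let l , Ll = L-bounded x
      u , Uu = U-bounded x
      k , u+1-l≤kδ = archimedean (u ℚ.+ 1ℚ ℚ.- l) 0<δ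
      u<l+kδ = ℚₚ.<-≤-trans (x<x+1 u)
        (subst (ℚ._≤ l ℚ.+ multiple k δ) (x+[y-x]≡y l (u ℚ.+ 1ℚ)) (ℚₚ.+-monoʳ-≤ l u+1-l≤kδ))
      a , La , Ua+2δ = march x 0<δ k l Ll (U-up x u<l+kδ Uu)
  in a , a ℚ.+ δ ℚ.+ δ , La , Ua+2δ , subst (ℚ._< ε) (2δ≡a+2δ-a a δ) 2δ<ε
  where
  open ℚ-Lemmas
  δ : ℚ
  δ = ½ ℚ.* (½ ℚ.* ε)
  0<½ε : 0ℚ ℚ.< ½ ℚ.* ε
  0<½ε = *-pos (ℚₚ.positive⁻¹ ½) 0<ε
  0<δ : 0ℚ ℚ.< δ
  0<δ = *-pos (ℚₚ.positive⁻¹ ½) 0<½ε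
  2δ<ε : δ ℚ.+ δ ℚ.< ε
  2δ<ε = subst₂ ℚ._<_ (sym (halve (½ ℚ.* ε))) (halve ε) (x<x+pos (½ ℚ.* ε) 0<½ε)

L<U : ∀ x {a b} → L x a → U x b → a ℚ.< b
L<U x {a} {b} La Ub with a ℚₚ.<? b
... | yes a<b = a<b
... | no  a≮b with b ℚₚ.<? a
...   | yes b<a = ⊥-elim (disjoint x (L-down x b<a La) Ub)
...   | no  b≮a = ⊥-elim (disjoint x (subst (L x) (ℚₚ.≤-antisym (ℚₚ.≮⇒≥ b≮a) (ℚₚ.≮⇒≥ a≮b)) La) Ub)

_+_ : ℝ → ℝ → ℝ
x + y = record
  { L         = λ q → ∃ λ a → L x a × L y (q ℚ.- a)
  ; U         = λ q → ∃ λ b → U x b × U y (q ℚ.- b)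
  ; L-bounded = let a , La = L-bounded x
                    c , Lc = L-bounded y
                in c ℚ.+ a , a , La , subst (L y) (sym (x+y-y≡x c a)) Lc
  ; U-bounded = let b , Ub = U-bounded x
                    d , Ud = U-bounded y
                in d ℚ.+ b , b , Ub , subst (U y) (sym (x+y-y≡x d b)) Ud
  ; L-down    = λ { q<r (a , La , Lr) → a , La , L-down y (ℚₚ.+-monoˡ-< (ℚ.- a) q<r) Lr }
  ; U-up      = λ { q<r (b , Ub , Uq) → b , Ub , U-up y (ℚₚ.+-monoˡ-< (ℚ.- b) q<r) Uq }
  ; L-open    = λ { {q} (a , La , Lq) → let s , q-a<s , Ls = L-open y Lq in
                  s ℚ.+ a , subst (ℚ._< s ℚ.+ a) (x-y+y≡x q a) (ℚₚ.+-monoˡ-< a q-a<s)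
                , a , La , subst (L y) (sym (x+y-y≡x s a)) Ls }
  ; U-open    = λ { {r} (b , Ub , Ur) → let s , s<r-b , Us = U-open y Ur in
                  s ℚ.+ b , subst (s ℚ.+ b ℚ.<_) (x-y+y≡x r b) (ℚₚ.+-monoˡ-< b s<r-b)
                , b , Ub , subst (U y) (sym (x+y-y≡x s b)) Us }
  ; disjoint  = λ { {q} (a , La , Lq) (b , Ub , Uq) →
                  ℚₚ.<-asym (ℚₚ.+-monoʳ-< q (ℚₚ.neg-antimono-< (L<U x La Ub))) (L<U y Lq Uq) }
  ; located   = loc
  }
  where
  open ℚ-Lemmas
  loc : ∀ {q r} → q ℚ.< r →
        (∃ λ a → L x a × L y (q ℚ.- a)) ⊎ (∃ λ b → U x b × U y (r ℚ.- b))
  loc {q} {r} q<r with approximate x (x<y⇒0<y-x q<r)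
  ... | a , b , La , Ub , b-a<r-q with located y (exchange-< {a} {b} {q} {r} b-a<r-q)
  ...   | inj₁ Lq-a = inj₁ (a , La , Lq-a)
  ...   | inj₂ Ur-b = inj₂ (b , Ub , Ur-b)

_-_ : ℝ → ℝ → ℝ
x - y = x + - y

√_ : ℕ → ℝ
√ n = record
  { L         = λ q → q ℚ.< 0ℚ ⊎ q ℚ.* q ℚ.< a
  ; U         = λ q → 0ℚ ℚ.< q × a ℚ.< q ℚ.* q
  ; L-bounded = ℚ.- 1ℚ , inj₁ (ℚₚ.negative⁻¹ (ℚ.- 1ℚ))
  ; U-bounded = a ℚ.+ 1ℚ , ℚₚ.≤-<-trans 0≤a (x<x+1 a) , a<[a+1]² 0≤a
  ; L-down    = down
  ; U-up      = λ { q<r (0<q , a<q²) → ℚₚ.<-trans 0<q q<r , ℚₚ.<-trans a<q² (square-mono-< (ℚₚ.<⇒≤ 0<q) q<r) }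
  ; L-open    = openˡ
  ; U-open    = λ (0<r , a<r²) → √-openʳ 0≤a 0<r a<r²
  ; disjoint  = λ { (inj₁ q<0) (0<q , _) → ℚₚ.<-asym q<0 0<q
                  ; (inj₂ q²<a) (_ , a<q²) → ℚₚ.<-asym q²<a a<q² }
  ; located   = loc
  }
  where
  open ℚ-Lemmas
  a : ℚ
  a = fromℤ (+ n)
  0≤a : 0ℚ ℚ.≤ a
  0≤a = 0≤fromℕ n
  P : ℚ → Set
  P q = q ℚ.< 0ℚ ⊎ q ℚ.* q ℚ.< a
  down : ∀ {q r} → q ℚ.< r → P r → P q
  down q<r (inj₁ r<0) = inj₁ (ℚₚ.<-trans q<r r<0)
  down {q} q<r (inj₂ r²<a) with q ℚₚ.<? 0ℚ
  ... | yes q<0 = inj₁ q<0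
  ... | no  q≮0 = inj₂ (ℚₚ.<-trans (square-mono-< (ℚₚ.≮⇒≥ q≮0) q<r) r²<a)
  openˡ : ∀ {q} → P q → ∃ λ r → q ℚ.< r × P r
  openˡ (inj₁ q<0) = let r , q<r , r<0 = ℚₚ.<-dense q<0 in r , q<r , inj₁ r<0
  openˡ {q} (inj₂ q²<a) with q ℚₚ.<? 0ℚ
  ... | yes q<0 = openˡ (inj₁ q<0)
  ... | no  q≮0 = let r , q<r , r²<a = √-openˡ 0≤a (ℚₚ.≮⇒≥ q≮0) q²<a in r , q<r , inj₂ r²<a
  loc : ∀ {q r} → q ℚ.< r → P q ⊎ (0ℚ ℚ.< r × a ℚ.< r ℚ.* r)
  loc {q} {r} q<r with q ℚₚ.<? 0ℚ
  ... | yes q<0 = inj₁ (inj₁ q<0)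
  ... | no  q≮0 with q ℚ.* q ℚₚ.<? a
  ...   | yes q²<a = inj₁ (inj₂ q²<a)
  ...   | no  q²≮a = inj₂ (ℚₚ.≤-<-trans (ℚₚ.≮⇒≥ q≮0) q<r
                          , ℚₚ.≤-<-trans (ℚₚ.≮⇒≥ q²≮a) (square-mono-< (ℚₚ.≮⇒≥ q≮0) q<r))


-- Decidability of adjacency is what makes degrees and cut sizes computable;
-- classically it is no restriction.
record Graph : Set₁ where
  infix 4 _~_ _~?_
  field
    order        : ℕ
    {{nonEmpty}} : ℕ.NonZero order
  Vertex : Set
  Vertex = Fin order
  field
    _~_      : Rel Vertex 0ℓ
    _~?_     : Decidable _~_
    ~-sym    : Symmetric _~_
    ~-irrefl : Irreflexive _≡_ _~_

subsets : ∀ n → List (Subset n)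
subsets zero    = [ []ᵛ ]
subsets (suc n) = map (outside ∷ᵛ_) (subsets n) ++ map (inside ∷ᵛ_) (subsets n)

∈-subsets : ∀ {n} (A : Subset n) → A ∈ˡ subsets n
∈-subsets []ᵛ            = here refl
∈-subsets (outside ∷ᵛ A) = ∈-++⁺ˡ (∈-map⁺ (outside ∷ᵛ_) (∈-subsets A))
∈-subsets (inside  ∷ᵛ A) = ∈-++⁺ʳ (map (outside ∷ᵛ_) (subsets _)) (∈-map⁺ (inside ∷ᵛ_) (∈-subsets A))

module _ (G : Graph) where
  open Graph G

  N : Vertex → Subset order
  N v = tabulate (λ u → does (v ~? u))

  Dominating : Subset order → Set
  Dominating D = ∀ v → v ∉ D → ∃ λ u → v ~ u × u ∈ D

  IrregularDominating : Subset order → Set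
  IrregularDominating D =
    Dominating D ×
    (∀ u v → u ∉ D → v ∉ D → u ≢ v → ∣ N u ∩ D ∣ ≢ ∣ N v ∩ D ∣)

  irregularDominating? : ∀ D → Dec (IrregularDominating D)
  irregularDominating? D =
    all? (λ v → ¬? (v ∈? D) →-dec any? (λ u → (v ~? u) ×-dec (u ∈? D)))
    ×-dec
    all? (λ u → all? (λ v → ¬? (u ∈? D) →-dec (¬? (v ∈? D) →-dec (¬? (u ≟ᶠ v) →-dec
      ¬? (∣ N u ∩ D ∣ ℕₚ.≟ ∣ N v ∩ D ∣)))))

  ⊤-irregularDominating : IrregularDominating ⊤
  ⊤-irregularDominating = (λ v v∉⊤ → ⊥-elim (v∉⊤ ∈⊤)) , λ u v u∉⊤ → ⊥-elim (u∉⊤ ∈⊤)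

  irregularDominatingSets : List (Subset order)
  irregularDominatingSets = filter irregularDominating? (subsets order)

  -- The first argument of min (of max in β) is one of the candidate values
  -- anyway, that of V(G) (of ∅), so it does not affect the result.
  γir : ℕ
  γir = min ∣ ⊤ {order} ∣ (map ∣_∣ irregularDominatingSets)

  -- each edge {u , v} is listed once, as the pair with u < v
  edges : List (Vertex × Vertex)
  edges = filter (λ (u , v) → (u <ᶠ? v) ×-dec (u ~? v)) (cartesianProduct (allFin order) (allFin order))

  Crosses : Subset order → Vertex × Vertex → Set
  Crosses A (u , v) = (u ∈ A × v ∉ A) ⊎ (u ∉ A × v ∈ A)

  crosses? : ∀ A e → Dec (Crosses A e)
  crosses? A (u , v) =
    ((u ∈? A) ×-dec ¬? (v ∈? A)) ⊎-dec (¬? (u ∈? A) ×-dec (v ∈? A))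

  cutSize : Subset order → ℕ
  cutSize A = length (filter (crosses? A) edges)

  β : ℕ
  β = max (cutSize ⊥) (map cutSize (subsets order))

  γir-attained : ∃ λ D → IrregularDominating D × ∣ D ∣ ≡ γir
  γir-attained with argmin-sel (λ k → k) ∣ ⊤ {order} ∣ (map ∣_∣ irregularDominatingSets)
  ... | inj₁ γ≡∣⊤∣ = ⊤ , ⊤-irregularDominating , sym γ≡∣⊤∣
  ... | inj₂ γ∈    =
    let D , D∈ , γ≡∣D∣ = ∈-map⁻ ∣_∣ γ∈
    in D , proj₂ (∈-filter⁻ irregularDominating? {xs = subsets order} D∈) , sym γ≡∣D∣

  γir-minimal : ∀ D → IrregularDominating D → γir ℕ.≤ ∣ D ∣
  γir-minimal D irr = lookup (min≤xs ∣ ⊤ {order} ∣ (map ∣_∣ irregularDominatingSets))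
    (∈-map⁺ ∣_∣ (∈-filter⁺ irregularDominating? (∈-subsets D) irr))

  β-attained : ∃ λ A → cutSize A ≡ β
  β-attained with argmax-sel (λ k → k) (cutSize ⊥) (map cutSize (subsets order))
  ... | inj₁ β≡ = ⊥ , sym β≡
  ... | inj₂ β∈ = let A , _ , β≡ = ∈-map⁻ cutSize β∈ in A , sym β≡

  β-maximal : ∀ A → cutSize A ℕ.≤ β
  β-maximal A = lookup (xs≤max (cutSize ⊥) (map cutSize (subsets order)))
    (∈-map⁺ cutSize (∈-subsets A))

{-# OPTIONS --safe #-}
module Submission where

-- Let D be an irregular dominating set with m = n − |D|.  The m numbers
-- |N(v) ∩ D| for v ∉ D are distinct and positive, so their sum, which is the
-- size of the cut D, is at least m (m + 1) / 2.  Hence (2m + 1)² ≤ 1 + 8 β,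
-- which is the bound.  K₂ has m = 1 and β = 1, hence equality.

open import Algebra.Properties.CommutativeMonoid.Sum as Sum using ()
open import Data.Bool.Base using (Bool; true; false; not; _∧_; if_then_else_)
open import Data.Bool.Properties using (∧-zeroʳ)
open import Data.Fin.Base using (Fin; zero; suc; fromℕ<; punchIn) renaming (_<_ to _<ᶠ_)
open import Data.Fin.Properties using (any?; fromℕ<-injective; injective⇒≤; punchIn-injective; <-cmp) renaming (_≟_ to _≟ᶠ_; _<?_ to _<ᶠ?_)
open import Data.Fin.Subset using (Subset; _∈_; _∉_; _∩_; ∣_∣)
open import Data.Fin.Subset.Properties using (_∈?_; x∈p∩q⁺; x∈p⇒∣p-x∣<∣p∣)
open import Data.Integer.Base as ℤ using ()
open import Data.Integer.Properties as ℤₚ using ()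
open import Data.List.Base as List using (List; []; _∷_; length; filter; tabulate; allFin; cartesianProduct; lookup)
open import Data.List.Membership.Propositional.Properties using (∈-lookup)
open import Data.List.Properties using (filter-++; length-++; map-tabulate)
open import Data.List.Relation.Unary.All as All using ()
open import Data.List.Relation.Unary.All.Properties using (all-filter)
open import Data.List.Relation.Unary.AllPairs using (_∷_)
open import Data.List.Relation.Unary.Unique.Propositional using (Unique)
open import Data.List.Relation.Unary.Unique.Propositional.Properties using (filter⁺; allFin⁺)
open import Data.Nat.Base as ℕ using (ℕ; zero; suc)
open import Data.Nat.Properties as ℕₚ using ()
open import Data.Nat.Tactic.RingSolver using (solve-∀)
open import Data.Product.Base using (∃; _×_; _,_)
open import Data.Rational.Base as ℚ using (ℚ; 0ℚ; 1ℚ; *≤*)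
open import Data.Rational.Literals using (fromℤ)
open import Data.Rational.Properties as ℚₚ using ()
open import Data.Rational.Solver using (module +-*-Solver)
open import Data.Rational.Unnormalised.Base using (*≡*)
open import Data.Rational.Unnormalised.Properties as ℚᵘₚ using ()
open import Data.Vec.Base using ([]; _∷_) renaming (lookup to lookupᵛ)
open import Data.Vec.Functional using (removeAt)
open import Data.Vec.Properties using (lookup-zipWith; lookup∘tabulate; lookup⇒[]=)
open import Function.Base using (_∘_; id)
open import Function.Bundles using (mk⇔)
open import Function.Definitions using (Injective)
open import Relation.Binary.Definitions using (tri<; tri≈; tri>)
open import Relation.Binary.PropositionalEquality using (_≡_; _≢_; refl; sym; trans; cong; cong₂; subst; subst₂; module ≡-Reasoning)
open import Relation.Nullary.Decidable using (yes; no; does; ¬?; _×-dec_; dec-false; dec-true; does-⇔; decidable-stable)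
open import Relation.Nullary.Negation using (contradiction)
open import Relation.Unary using (Decidable)
open import Defs using (module ℚ-Lemmas; Graph; IrregularDominating; cutSize; crosses?; γir; β; γir-attained; β-maximal)

-- Sums of distinct positive integers.

module Counting where
  open import Defs using (N)
  open import Data.Nat.Base using (_+_; _*_; _≤_; _<_; pred; z≤n; >-nonZero)
  open Sum ℕₚ.+-0-commutativeMonoid using (sum; sum-syntax; sum-remove; sum-cong-≗; sum-replicate-zero; ∑-distrib-+; ∑-comm)

  -- Pigeonhole: if all values were at most `m`, their predecessors would give an injection from
  -- `Fin (suc m)` to `Fin m`. The search over a finite type is decidable, so refuting its failure
  -- yields the index itself.
  injective⇒large-value : ∀ {m} (f : Fin (suc m) → ℕ) → Injective _≡_ _≡_ f → (∀ i → 0 < f i) →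
                          ∃ λ i → suc m ≤ f i
  injective⇒large-value {m} f inj 0<f = decidable-stable (any? (λ i → suc m ℕₚ.≤? f i)) λ none →
    let small : ∀ i → pred (f i) < m
        small i = ℕₚ.pred-mono-< {{>-nonZero (0<f i)}} (ℕₚ.≰⇒> λ le → none (i , le))
    in ℕₚ.1+n≰n (injective⇒≤ {f = λ i → fromℕ< (small i)} λ {i} {j} eq →
         inj (ℕₚ.pred-injective {{>-nonZero (0<f i)}} {{>-nonZero (0<f j)}}
              (fromℕ<-injective _ _ (small i) (small j) eq)))

  -- Induction on the number of values: an index with a value at least as large as that number is
  -- removed, and the remaining values are still distinct and positive. No sorting is involved. The
  -- factor 2 avoids division.
  triangular-≤-sum : ∀ {m} (f : Fin m → ℕ) → Injective _≡_ _≡_ f → (∀ i → 0 < f i) →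
                     m * suc m ≤ 2 * sum f
  triangular-≤-sum {zero}  f inj 0<f = z≤n
  triangular-≤-sum {suc m} f inj 0<f with injective⇒large-value f inj 0<f
  ... | i , 1+m≤fi = begin
    suc m * suc (suc m)               ≡⟨ shift m ⟩
    2 * suc m + m * suc m             ≤⟨ ℕₚ.+-mono-≤ (ℕₚ.*-monoʳ-≤ 2 1+m≤fi)
                                           (triangular-≤-sum (removeAt f i)
                                           (λ {j} {k} eq → punchIn-injective i j k (inj eq)) (0<f ∘ punchIn i)) ⟩
    2 * f i + 2 * sum (removeAt f i)  ≡⟨ ℕₚ.*-distribˡ-+ 2 (f i) _ ⟨
    2 * (f i + sum (removeAt f i))    ≡⟨ cong (2 *_) (sum-remove {i = i} f) ⟨
    2 * sum f                         ∎
    where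
    open ℕₚ.≤-Reasoning
    shift : ∀ m → suc m * suc (suc m) ≡ 2 * suc m + m * suc m
    shift = solve-∀

  -- Counts and sums over lists, subsets and pairs.

  Unique⇒lookup-injective : ∀ {A : Set} {xs : List A} → Unique xs → Injective _≡_ _≡_ (lookup xs)
  Unique⇒lookup-injective (_   ∷ _)  {zero}  {zero}  _  = refl
  Unique⇒lookup-injective (x∉xs ∷ _) {zero}  {suc j} eq = contradiction eq (All.lookup x∉xs (∈-lookup j))
  Unique⇒lookup-injective (x∉xs ∷ _) {suc i} {zero}  eq = contradiction (sym eq) (All.lookup x∉xs (∈-lookup i))
  Unique⇒lookup-injective (_ ∷ xs!)  {suc i} {suc j} eq = cong suc (Unique⇒lookup-injective xs! eq)

  𝟙 : Bool → ℕ
  𝟙 b = if b then 1 else 0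

  module _ {A : Set} {P : A → Set} (P? : Decidable P) where

    length-filter-tabulate : ∀ {n} (g : Fin n → A) →
      length (filter P? (tabulate g)) ≡ ∑[ i < n ] 𝟙 (does (P? (g i)))
    length-filter-tabulate {zero}  g = refl
    length-filter-tabulate {suc n} g with does (P? (g zero))
    ... | true  = cong suc (length-filter-tabulate (g ∘ suc))
    ... | false = length-filter-tabulate (g ∘ suc)

    -- Replaces a sum indexed by the complement of D by one over all vertices, the form in which
    -- summations can be interchanged.
    sum-lookup-filter-tabulate : ∀ {n} (f : A → ℕ) (g : Fin n → A) →
      sum (f ∘ lookup (filter P? (tabulate g))) ≡ ∑[ i < n ] (if does (P? (g i)) then f (g i) else 0)
    sum-lookup-filter-tabulate {zero}  f g = refl
    sum-lookup-filter-tabulate {suc n} f g with does (P? (g zero))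
    ... | true  = cong (f (g zero) +_) (sum-lookup-filter-tabulate f (g ∘ suc))
    ... | false = sum-lookup-filter-tabulate f (g ∘ suc)

    -- Serves to unfold `cutSize`, which filters the already filtered list `edges`.
    length-filter-filter : ∀ {Q : A → Set} (Q? : Decidable Q) xs →
      length (filter Q? (filter P? xs)) ≡ length (filter (λ x → P? x ×-dec Q? x) xs)
    length-filter-filter Q? []       = refl
    length-filter-filter Q? (x ∷ xs) with does (P? x)
    ... | false = length-filter-filter Q? xs
    ... | true with does (Q? x)
    ...   | true  = cong suc (length-filter-filter Q? xs)
    ...   | false = length-filter-filter Q? xs

  length-filter-cartesianProduct : ∀ {A B : Set} {P : A × B → Set} (P? : Decidable P)
    {m n} (f : Fin m → A) (g : Fin n → B) →
    length (filter P? (cartesianProduct (tabulate f) (tabulate g)))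
      ≡ ∑[ i < m ] ∑[ j < n ] 𝟙 (does (P? (f i , g j)))
  length-filter-cartesianProduct P? {zero}  f g = refl
  length-filter-cartesianProduct P? {suc m} {n} f g = begin
    length (filter P? (row List.++ rest))                ≡⟨ cong length (filter-++ P? row rest) ⟩
    length (filter P? row List.++ filter P? rest)        ≡⟨ length-++ (filter P? row) ⟩
    length (filter P? row) + length (filter P? rest)
      ≡⟨ cong₂ _+_ (trans (cong (length ∘ filter P?) (map-tabulate g (f zero ,_)))
                          (length-filter-tabulate P? (λ j → f zero , g j)))
                   (length-filter-cartesianProduct P? (f ∘ suc) g) ⟩
    (∑[ i < suc m ] ∑[ j < n ] 𝟙 (does (P? (f i , g j)))) ∎
    where
    open ≡-Reasoning
    row  = List.map (f zero ,_) (tabulate g)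
    rest = cartesianProduct (tabulate (f ∘ suc)) (tabulate g)

  does-∈? : ∀ {n} (i : Fin n) (p : Subset n) → does (i ∈? p) ≡ lookupᵛ p i
  does-∈? zero    (true  ∷ p) = refl
  does-∈? zero    (false ∷ p) = refl
  does-∈? (suc i) (_     ∷ p) = does-∈? i p

  ∣p∣≡∑ : ∀ {n} (p : Subset n) → ∣ p ∣ ≡ ∑[ i < n ] 𝟙 (lookupᵛ p i)
  ∣p∣≡∑ []          = refl
  ∣p∣≡∑ (true  ∷ p) = cong suc (∣p∣≡∑ p)
  ∣p∣≡∑ (false ∷ p) = ∣p∣≡∑ p

  ∑1≡n : ∀ n → ∑[ i < n ] 1 ≡ n
  ∑1≡n zero    = refl
  ∑1≡n (suc n) = cong suc (∑1≡n n)

  -- A list rather than a `Subset`, so that `lookup` indexes the complement by `Fin m`, as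
  -- `triangular-≤-sum` requires.
  elements∁ : ∀ {n} → Subset n → List (Fin n)
  elements∁ p = filter (¬? ∘ (_∈? p)) (allFin _)

  ∣p∣+length-elements∁ : ∀ {n} (p : Subset n) → ∣ p ∣ + length (elements∁ p) ≡ n
  ∣p∣+length-elements∁ {n} p = begin
    ∣ p ∣ + length (elements∁ p)
      ≡⟨ cong₂ _+_ (∣p∣≡∑ p) (length-filter-tabulate (¬? ∘ (_∈? p)) id) ⟩
    (∑[ i < n ] 𝟙 (lookupᵛ p i)) + (∑[ i < n ] 𝟙 (not (does (i ∈? p))))
      ≡⟨ ∑-distrib-+ (𝟙 ∘ lookupᵛ p) (λ i → 𝟙 (not (does (i ∈? p)))) ⟨
    (∑[ i < n ] (𝟙 (lookupᵛ p i) + 𝟙 (not (does (i ∈? p)))))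
      ≡⟨ sum-cong-≗ {n} (λ i → trans (cong (λ b → 𝟙 (lookupᵛ p i) + 𝟙 (not b)) (does-∈? i p))
                                   (excluded-middle (lookupᵛ p i))) ⟩
    (∑[ i < n ] 1)  ≡⟨ ∑1≡n n ⟩
    n               ∎
    where
    open ≡-Reasoning
    excluded-middle : ∀ b → 𝟙 b + 𝟙 (not b) ≡ 1
    excluded-middle true  = refl
    excluded-middle false = refl

  -- Off the diagonal either i < j or j < i, and interchanging the two summations folds the second
  -- case onto the first. This reconciles sums over ordered pairs with `edges`, where each edge
  -- appears only as the pair with u < v.
  ∑∑-split-< : ∀ {n} (f : Fin n → Fin n → ℕ) → (∀ i → f i i ≡ 0) →
    ∑[ i < n ] ∑[ j < n ] f i j ≡ ∑[ i < n ] ∑[ j < n ] (if does (i <ᶠ? j) then f i j + f j i else 0)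
  ∑∑-split-< {n} f f-diag = begin
    (∑[ i < n ] ∑[ j < n ] f i j)
      ≡⟨ sum-cong-≗ {n} (λ i → trans (sum-cong-≗ {n} (split i)) (∑-distrib-+ (upper i) (λ j → upper′ j i))) ⟩
    (∑[ i < n ] ((∑[ j < n ] upper i j) + (∑[ j < n ] upper′ j i)))
      ≡⟨ ∑-distrib-+ (λ i → ∑[ j < n ] upper i j) _ ⟩
    (∑[ i < n ] ∑[ j < n ] upper i j) + (∑[ i < n ] ∑[ j < n ] upper′ j i)
      ≡⟨ cong ((∑[ i < n ] ∑[ j < n ] upper i j) +_) (∑-comm {n} {n} (λ i j → upper′ j i)) ⟩
    (∑[ i < n ] ∑[ j < n ] upper i j) + (∑[ i < n ] ∑[ j < n ] upper′ i j)
      ≡⟨ ∑-distrib-+ (λ i → ∑[ j < n ] upper i j) _ ⟨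
    (∑[ i < n ] ((∑[ j < n ] upper i j) + (∑[ j < n ] upper′ i j)))
      ≡⟨ sum-cong-≗ {n} (λ i → trans (sym (∑-distrib-+ (upper i) (upper′ i)))
                                   (sum-cong-≗ {n} (λ j → if-+ (does (i <ᶠ? j))))) ⟩
    (∑[ i < n ] ∑[ j < n ] (if does (i <ᶠ? j) then f i j + f j i else 0)) ∎
    where
    open ≡-Reasoning
    upper upper′ : Fin n → Fin n → ℕ
    upper  i j = if does (i <ᶠ? j) then f i j else 0
    upper′ i j = if does (i <ᶠ? j) then f j i else 0
    if-+ : ∀ b {x y} → (if b then x else 0) + (if b then y else 0) ≡ (if b then x + y else 0)
    if-+ true  = refl
    if-+ false = refl
    split : ∀ i j → f i j ≡ upper i j + upper′ j i
    split i j with <-cmp i j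
    ... | tri< i<j _ j≮i rewrite dec-true (i <ᶠ? j) i<j | dec-false (j <ᶠ? i) j≮i = sym (ℕₚ.+-identityʳ _)
    ... | tri> i≮j _ j<i rewrite dec-false (i <ᶠ? j) i≮j | dec-true (j <ᶠ? i) j<i = refl
    ... | tri≈ i≮j refl j≮i rewrite dec-false (i <ᶠ? i) i≮j = f-diag i

  -- The edges between a vertex set and its complement.

  module _ (G : Graph) where
    open Graph G using (_~_; _~?_; ~-sym) renaming (order to n)

    -- Double counting: each crossing edge is counted once, at its endpoint outside A.
    ∑-outside≡cutSize : ∀ A →
      ∑[ v < n ] (if does (¬? (v ∈? A)) then ∣ N G v ∩ A ∣ else 0) ≡ cutSize G A
    ∑-outside≡cutSize A = begin
      (∑[ v < n ] (if not (a v) then ∣ N G v ∩ A ∣ else 0))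
        ≡⟨ sum-cong-≗ {n} row ⟩
      (∑[ v < n ] ∑[ u < n ] out v u)
        ≡⟨ ∑∑-split-< out out-diag ⟩
      (∑[ u < n ] ∑[ v < n ] (if does (u <ᶠ? v) then out u v + out v u else 0))
        ≡⟨ sum-cong-≗ {n} (λ u → sum-cong-≗ {n} (cell u)) ⟩
      (∑[ u < n ] ∑[ v < n ] 𝟙 (does (((u <ᶠ? v) ×-dec (u ~? v)) ×-dec crosses? G A (u , v))))
        ≡⟨ length-filter-cartesianProduct (λ e → edge? e ×-dec crosses? G A e) id id ⟨
      length (filter (λ e → edge? e ×-dec crosses? G A e) (cartesianProduct (allFin n) (allFin n)))
        ≡⟨ length-filter-filter edge? (crosses? G A) (cartesianProduct (allFin n) (allFin n)) ⟨
      cutSize G A ∎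
      where
      open ≡-Reasoning
      edge? : Decidable λ (u , v) → u <ᶠ v × u ~ v
      edge? (u , v) = (u <ᶠ? v) ×-dec (u ~? v)
      a : Fin n → Bool
      a v = does (v ∈? A)
      out : Fin n → Fin n → ℕ
      out v u = if not (a v) then 𝟙 (does (v ~? u) ∧ a u) else 0
      out-diag : ∀ v → out v v ≡ 0
      out-diag v with a v
      ... | true = refl
      ... | false = cong 𝟙 (∧-zeroʳ _)
      row : ∀ v → (if not (a v) then ∣ N G v ∩ A ∣ else 0) ≡ ∑[ u < n ] out v u
      row v with a v
      ... | true  = sym (sum-replicate-zero n)
      ... | false = trans (∣p∣≡∑ (N G v ∩ A)) (sum-cong-≗ {n} λ u → cong 𝟙
        (trans (lookup-zipWith _∧_ u (N G v) A) (cong₂ _∧_ (lookup∘tabulate _ u) (sym (does-∈? u A)))))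
      cell : ∀ u v → (if does (u <ᶠ? v) then out u v + out v u else 0)
                   ≡ 𝟙 (does (((u <ᶠ? v) ×-dec (u ~? v)) ×-dec crosses? G A (u , v)))
      -- By symmetry both summands test the same adjacency, so a truth table in four Booleans
      -- remains. At most one summand is 1, since the endpoint outside `A` is determined by the
      -- crossing edge.
      cell u v rewrite does-⇔ (mk⇔ ~-sym ~-sym) (v ~? u) (u ~? v)
        with does (u <ᶠ? v) | does (u ~? v) | a u | a v
      ... | false | _     | _     | _     = refl
      ... | true  | false | true  | true  = refl
      ... | true  | false | true  | false = refl
      ... | true  | false | false | true  = refl
      ... | true  | false | false | false = refl
      ... | true  | true  | true  | true  = refl
      ... | true  | true  | true  | false = refl
      ... | true  | true  | false | true  = refl
      ... | true  | true  | false | false = refl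

    -- The numbers of neighbours in `D` of the vertices outside `D` are positive by domination and
    -- distinct by irregularity; by double counting they sum to the size of the cut.
    triangular-≤-cutSize : ∀ D → IrregularDominating G D →
      let m = length (elements∁ D) in m * suc m ≤ 2 * cutSize G D
    triangular-≤-cutSize D (dominating , irregular) =
      subst (λ c → m * suc m ≤ 2 * c)
        (trans (sum-lookup-filter-tabulate (¬? ∘ (_∈? D)) degree id) (∑-outside≡cutSize D))
        (triangular-≤-sum (degree ∘ vertex) degree-injective degree-positive)
      where
      m : ℕ
      m = length (elements∁ D)
      degree : Fin n → ℕ
      degree v = ∣ N G v ∩ D ∣
      vertex : Fin m → Fin n
      vertex = lookup (elements∁ D)
      vertex∉D : ∀ i → vertex i ∉ D
      vertex∉D i = All.lookup (all-filter (¬? ∘ (_∈? D)) (allFin n)) (∈-lookup i)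
      degree-injective : Injective _≡_ _≡_ (degree ∘ vertex)
      -- `irregular` is in contrapositive form, so decidable equality gives equal vertices; equal
      -- indices follow because the list has no repetitions.
      degree-injective {i} {j} eq = Unique⇒lookup-injective (filter⁺ (¬? ∘ (_∈? D)) (allFin⁺ n))
        (decidable-stable (vertex i ≟ᶠ vertex j) λ i≢j →
          irregular (vertex i) (vertex j) (vertex∉D i) (vertex∉D j) i≢j eq)
      degree-positive : ∀ i → 0 < degree (vertex i)
      degree-positive i with dominating (vertex i) (vertex∉D i)
      ... | u , v~u , u∈D =
        -- Deleting `u` from the intersection makes it strictly smaller, so its size was positive.
        ℕₚ.≤-<-trans z≤n (x∈p⇒∣p-x∣<∣p∣ (x∈p∩q⁺ (u∈N , u∈D)))
        where
        u∈N : u ∈ N G (vertex i)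
        u∈N = lookup⇒[]= u _ (trans (lookup∘tabulate _ u) (dec-true (vertex i ~? u) v~u))

  -- Completing the square in m (m + 1) ≤ 2 β gives a form that can be compared with `√` by squaring
  -- alone.
  odd²≤1+8β : ∀ G D → IrregularDominating G D →
    let m = length (elements∁ D) in suc (m + m) * suc (m + m) ≤ 1 + 8 * β G
  odd²≤1+8β G D irr = begin
    suc (m + m) * suc (m + m)    ≡⟨ complete-square m ⟩
    1 + 4 * (m * suc m)          ≤⟨ ℕₚ.+-monoʳ-≤ 1 (ℕₚ.*-monoʳ-≤ 4 (triangular-≤-cutSize G D irr)) ⟩
    1 + 4 * (2 * cutSize G D)    ≤⟨ ℕₚ.+-monoʳ-≤ 1 (ℕₚ.*-monoʳ-≤ 4 (ℕₚ.*-monoʳ-≤ 2 (β-maximal G D))) ⟩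
    1 + 4 * (2 * β G)            ≡⟨ cong suc (ℕₚ.*-assoc 4 2 (β G)) ⟨
    1 + 8 * β G                  ∎
    where
    open ℕₚ.≤-Reasoning
    m : ℕ
    m = length (elements∁ D)
    complete-square : ∀ m → suc (m + m) * suc (m + m) ≡ 1 + 4 * (m * suc m)
    complete-square = solve-∀

-- From natural numbers to Dedekind cuts.

open import Defs using (fromℕ; _≤_; _+_; _-_; _/2; √_; _≥_; _≈_)
open Graph using (order)

open ℚ-Lemmas
open +-*-Solver

ℕ⇒ℚ : ℕ → ℚ
ℕ⇒ℚ n = fromℤ (ℤ.+ n)

ℕ⇒ℚ-homo-+ : ∀ a b → ℕ⇒ℚ (a ℕ.+ b) ≡ ℕ⇒ℚ a ℚ.+ ℕ⇒ℚ b
ℕ⇒ℚ-homo-+ a b = sym (ℚₚ.toℚᵘ-injective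
  (ℚᵘₚ.≃-trans (ℚₚ.toℚᵘ-homo-+ (ℕ⇒ℚ a) (ℕ⇒ℚ b))
               (*≡* (cong (ℤ._* ℤ.+ 1) (cong₂ ℤ._+_ (ℤₚ.*-identityʳ (ℤ.+ a)) (ℤₚ.*-identityʳ (ℤ.+ b)))))))

ℕ⇒ℚ-homo-* : ∀ a b → ℕ⇒ℚ (a ℕ.* b) ≡ ℕ⇒ℚ a ℚ.* ℕ⇒ℚ b
ℕ⇒ℚ-homo-* a b = sym (ℚₚ.toℚᵘ-injective
  (ℚᵘₚ.≃-trans (ℚₚ.toℚᵘ-homo-* (ℕ⇒ℚ a) (ℕ⇒ℚ b))
               (*≡* (cong (ℤ._* ℤ.+ 1) (sym (ℤₚ.pos-* a b))))))

ℕ⇒ℚ-mono-≤ : ∀ {a b} → a ℕ.≤ b → ℕ⇒ℚ a ℚ.≤ ℕ⇒ℚ b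
ℕ⇒ℚ-mono-≤ a≤b = *≤* (ℤₚ.*-monoʳ-≤-nonNeg (ℤ.+ 1) (ℤ.+≤+ a≤b))

-- Otherwise 0 ≤ y ≤ x, and squaring preserves this order.
square-cancel-< : ∀ {x y} → 0ℚ ℚ.≤ y → x ℚ.* x ℚ.< y ℚ.* y → x ℚ.< y
square-cancel-< {x} {y} 0≤y x²<y² with x ℚₚ.<? y
... | yes x<y = x<y
... | no  x≮y with y ℚₚ.<? x
...   | yes y<x = contradiction (square-mono-< 0≤y y<x) (ℚₚ.<-asym x²<y²)
...   | no  y≮x = contradiction
  (subst (λ z → x ℚ.* x ℚ.< z ℚ.* z) (ℚₚ.≤-antisym (ℚₚ.≮⇒≥ x≮y) (ℚₚ.≮⇒≥ y≮x)) x²<y²) (ℚₚ.<-irrefl refl)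

double-cancel-< : ∀ {x y} → x ℚ.+ x ℚ.< y ℚ.+ y → x ℚ.< y
double-cancel-< {x} {y} h = subst₂ ℚ._<_ (½-double x) (½-double y) (½-mono-< h)

ℕ⇒ℚ-odd : ∀ m → ℕ⇒ℚ (suc (m ℕ.+ m)) ≡ 1ℚ ℚ.+ (ℕ⇒ℚ m ℚ.+ ℕ⇒ℚ m)
ℕ⇒ℚ-odd m = trans (ℕ⇒ℚ-homo-+ 1 (m ℕ.+ m)) (cong (1ℚ ℚ.+_) (ℕ⇒ℚ-homo-+ m m))

-- In the application `g` is |D|, `m` counts the vertices outside D, `n` is the order and `k` is 1 +
-- 8 β.
module _ {g m n k : ℕ} (g+m≡n : g ℕ.+ m ≡ n) where

  private
    G M N T K : ℚ
    G = ℕ⇒ℚ g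
    M = ℕ⇒ℚ m
    N = ℕ⇒ℚ n
    T = ℕ⇒ℚ (suc (m ℕ.+ m))
    K = ℕ⇒ℚ k

    N≡G+M : N ≡ G ℚ.+ M
    N≡G+M = trans (cong ℕ⇒ℚ (sym g+m≡n)) (ℕ⇒ℚ-homo-+ g m)

  -- q lies in the lower cut of n + (1 − √k)/2 iff √k < s = b − 2 (q − a) for
  -- some a < n and b < 1.
  odd²≤⇒root-bound : suc (m ℕ.+ m) ℕ.* suc (m ℕ.+ m) ℕ.≤ k →
                     fromℕ n + (fromℕ 1 - √ k) /2 ≤ fromℕ g
  odd²≤⇒root-bound t²≤k {q} (a , a<N , b , b<1 , 0<s , k<s²) =
    -- G - q is the sum of the positive numbers -(x + M) and G + M - a.
    0<y-x⇒x<y (subst (0ℚ ℚ.<_) (identity₂ G M a q) (+-pos (x<y⇒0<y-x x+M<0) (x<y⇒0<y-x a<G+M)))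
    where
    x s : ℚ
    x = q ℚ.- a
    s = ℚ.- (x ℚ.+ x ℚ.- b)
    a<G+M : a ℚ.< G ℚ.+ M
    a<G+M = subst (a ℚ.<_) N≡G+M a<N
    t<s : 1ℚ ℚ.+ (M ℚ.+ M) ℚ.< s
    t<s = subst (ℚ._< s) (ℕ⇒ℚ-odd m) (square-cancel-< (ℚₚ.<⇒≤ 0<s) (ℚₚ.≤-<-trans
      (subst (ℚ._≤ K) (ℕ⇒ℚ-homo-* (suc (m ℕ.+ m)) (suc (m ℕ.+ m))) (ℕ⇒ℚ-mono-≤ t²≤k)) k<s²))
    identity₁ : ∀ M b x →
      1ℚ ℚ.- b ℚ.+ (ℚ.- (x ℚ.+ x ℚ.- b) ℚ.- (1ℚ ℚ.+ (M ℚ.+ M))) ≡ 0ℚ ℚ.- ((x ℚ.+ M) ℚ.+ (x ℚ.+ M))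
    identity₁ = solve 3 (λ M b x → let u = con 1ℚ in
      u :- b :+ ((:- (x :+ x :- b)) :- (u :+ (M :+ M))) := con 0ℚ :- ((x :+ M) :+ (x :+ M))) refl
    identity₂ : ∀ G M a q → 0ℚ ℚ.- (q ℚ.- a ℚ.+ M) ℚ.+ (G ℚ.+ M ℚ.- a) ≡ G ℚ.- q
    identity₂ = solve 4 (λ G M a q → con 0ℚ :- (q :- a :+ M) :+ (G :+ M :- a) := G :- q) refl
    x+M<0 : x ℚ.+ M ℚ.< 0ℚ
    -- 1 - b and s - (1 + 2M) are positive and add up to -2 (x + M).
    x+M<0 = double-cancel-< (0<y-x⇒x<y (subst (0ℚ ℚ.<_) (identity₁ M b x)
      (+-pos (x<y⇒0<y-x b<1) (x<y⇒0<y-x t<s))))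

  -- The direction for sharpness: here √k ≤ 2m + 1, so (1 - √k)/2 ≥ -m. In terms of cuts, a < n and
  -- b < 1 must be found with √k < b - 2 (q - a).
  odd²≥⇒root-bound : k ℕ.≤ suc (m ℕ.+ m) ℕ.* suc (m ℕ.+ m) →
                     fromℕ g ≤ fromℕ n + (fromℕ 1 - √ k) /2
  odd²≥⇒root-bound k≤t² {q} q<G =
    -- With a strictly between q + M and G + M = N, the gap 2a - 2 (q + M) is positive. Any e inside
    -- it allows b = 1 - e, because s - (2m + 1) is then the gap minus e.
    let a , q+M<a , a<G+M = ℚₚ.<-dense (ℚₚ.+-monoˡ-< M q<G)
        e , 0<e , e<gap   = ℚₚ.<-dense (x<y⇒0<y-x (double-mono-< q+M<a))
    in a , subst (a ℚ.<_) (sym N≡G+M) a<G+M , 1ℚ ℚ.- e , 1-e<1 0<e , s-upper a e e<gap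
    where
    1-e<1 : ∀ {e} → 0ℚ ℚ.< e → 1ℚ ℚ.- e ℚ.< 1ℚ
    1-e<1 {e} 0<e = 0<y-x⇒x<y (subst (0ℚ ℚ.<_) (solve 2 (λ u e → e := u :- (u :- e)) refl 1ℚ e) 0<e)
    identity : ∀ M a e q →
      a ℚ.+ a ℚ.- (q ℚ.+ M ℚ.+ (q ℚ.+ M)) ℚ.- e
        ≡ ℚ.- (q ℚ.- a ℚ.+ (q ℚ.- a) ℚ.- (1ℚ ℚ.- e)) ℚ.- (1ℚ ℚ.+ (M ℚ.+ M))
    identity = solve 4 (λ M a e q → let u = con 1ℚ in
      a :+ a :- (q :+ M :+ (q :+ M)) :- e
        := (:- (q :- a :+ (q :- a) :- (u :- e))) :- (u :+ (M :+ M))) refl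
    s : ℚ → ℚ → ℚ
    s a e = ℚ.- (q ℚ.- a ℚ.+ (q ℚ.- a) ℚ.- (1ℚ ℚ.- e))
    s-upper : ∀ a e → e ℚ.< a ℚ.+ a ℚ.- (q ℚ.+ M ℚ.+ (q ℚ.+ M)) →
              0ℚ ℚ.< s a e × K ℚ.< s a e ℚ.* s a e
    s-upper a e e<gap =
      ℚₚ.≤-<-trans (0≤fromℕ (suc (m ℕ.+ m))) t<s ,
      ℚₚ.≤-<-trans (subst (K ℚ.≤_) (ℕ⇒ℚ-homo-* (suc (m ℕ.+ m)) (suc (m ℕ.+ m))) (ℕ⇒ℚ-mono-≤ k≤t²))
        (square-mono-< (0≤fromℕ (suc (m ℕ.+ m))) t<s)
      where
      t<s : T ℚ.< s a e
      t<s = subst (ℚ._< s a e) (sym (ℕ⇒ℚ-odd m))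
        (0<y-x⇒x<y (subst (0ℚ ℚ.<_) (identity M a e q) (x<y⇒0<y-x e<gap)))

-- The bound and its sharpness.

γir-bound : ∀ G → fromℕ (γir G) ≥ fromℕ (order G) + (fromℕ 1 - √ (1 ℕ.+ 8 ℕ.* β G)) /2
γir-bound G =
  let D , irr , ∣D∣≡γ = γir-attained G
  in odd²≤⇒root-bound
       (trans (cong (ℕ._+ length (elements∁ D)) (sym ∣D∣≡γ)) (∣p∣+length-elements∁ D))
       (odd²≤1+8β G D irr)
  where open Counting

K₂ : Graph
K₂ = record
  { order    = 2
  ; _~_      = _≢_
  ; _~?_     = λ u v → ¬? (u ≟ᶠ v)
  ; ~-sym    = λ u≢v → u≢v ∘ sym
  ; ~-irrefl = λ u≡v u≢v → u≢v u≡v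
  }

theorem4p2 : (∀ (G : Graph) →
    fromℕ (γir G) ≥ fromℕ (order G) + (fromℕ 1 - √ (1 ℕ.+ 8 ℕ.* β G)) /2)
    ×
    (∃ λ (G : Graph) →
    fromℕ (γir G) ≈ fromℕ (order G) + (fromℕ 1 - √ (1 ℕ.+ 8 ℕ.* β G)) /2)
-- For `K₂` both `γir` and `β` evaluate to 1, so `refl` checks 1 + 1 = 2 and `≤-refl` checks 1 + 8 =
-- 3².
theorem4p2 = γir-bound , K₂ , odd²≥⇒root-bound {g = 1} {m = 1} refl ℕₚ.≤-refl , γir-bound K₂
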